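{- Let $G$ be a finite simple connected graph, let $S\subseteq V(G)$ with $|S|\geq 2$, and let $T_1,\dots,T_k$ ($k\geq 2$) be $S$-Steiner trees in $G$. Then $T_1,\dots,T_k$ are completely independent $S$-Steiner trees if and only if they are pairwise edge-disjoint and, for every vertex $w\in V(G)$, there is at most one index $i$ with $d_{T_i}(w)>1$.
   Context: For $S\subseteq V(G)$ with $|S|\ge 2$, an $S$-Steiner tree of $G$ is a subtree $T$ of $G$ with $S\subseteq V(T)$ all of whose leaves belong to $S$. $S$-Steiner trees $T_1,\dots,T_k$ are called completely independent $S$-Steiner trees (CISSTs) if for all $1\le p<q\le k$: $E(T_p)\cap E(T_q)=\emptyset$, $V(T_p)\cap V(T_q)=S$, and for any two vertices $x_1,x_2\in S$ the $(x_1,x_2)$-paths in $T_p$ and in $T_q$ are internally disjoint. $d_{T}(w)$ denotes the degree of $w$ in $T$ (taken to be $0$ if $w\notin V(T)$). -}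

module Defs where

open import Data.Nat using (ℕ; _≤_)
open import Data.Fin as Fin using (Fin)
open import Data.Fin.Subset using (Subset; Nonempty; _∈_; _⊆_; _∩_; ∣_∣)
open import Data.List using (List; []; _∷_; length)
import Data.List.Membership.Propositional as List
open import Data.List.Relation.Unary.Unique.Propositional using (Unique)
open import Data.Product using (_×_)
open import Data.Sum using (_⊎_)
open import Relation.Binary.Construct.Closure.ReflexiveTransitive using (Star; ε; _◅_)
open import Relation.Binary.PropositionalEquality using (_≡_; _≢_)
open import Relation.Nullary using (¬_)

-- A finite simple graph whose vertices are taken from Fin n. The vertex set is
-- a subset of Fin n rather than all of it, so that a graph and its subgraphs
-- have the same type. N v is the set of neighbours of v.
record Graph (n : ℕ) : Set where
  field
    V        : Subset n
    N        : Fin n → Subset n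
    N-vertex : ∀ {u v} → v ∈ N u → u ∈ V
    N-sym    : ∀ {u v} → v ∈ N u → u ∈ N v
    N-irrefl : ∀ {v} → ¬ v ∈ N v

open Graph public

module _ {n : ℕ} where

  Adj : Graph n → Fin n → Fin n → Set
  Adj G u v = v ∈ N G u

  -- For v ∉ V G this is 0, by N-vertex.
  degree : Graph n → Fin n → ℕ
  degree G v = ∣ N G v ∣

  IsLeaf : Graph n → Fin n → Set
  IsLeaf G v = v ∈ V G × degree G v ≡ 1

  record IsSubgraph (H G : Graph n) : Set where
    field
      V-⊆ : V H ⊆ V G
      E-⊆ : ∀ u v → Adj H u v → Adj G u v

  Walk : Graph n → Fin n → Fin n → Set
  Walk G = Star (Adj G)

  vertices : ∀ {R : Fin n → Fin n → Set} {u v} → Star R u v → List (Fin n)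
  vertices {u = u} ε       = u ∷ []
  vertices {u = u} (_ ◅ w) = u ∷ vertices w

  IsPath : ∀ {R : Fin n → Fin n → Set} {u v} → Star R u v → Set
  IsPath w = Unique (vertices w)

  record IsConnected (G : Graph n) : Set where
    field
      nonempty : Nonempty (V G)
      joined   : ∀ {u v} → u ∈ V G → v ∈ V G → Walk G u v

  -- A cycle is a path on at least three vertices together with an edge joining
  -- its last vertex to its first.
  record Cycle (G : Graph n) : Set where
    field
      {first last} : Fin n
      path         : Walk G first last
      isPath       : IsPath path
      long         : 3 ≤ length (vertices path)
      closing      : Adj G last first

  record IsTree (T : Graph n) : Set where
    field
      connected : IsConnected T
      acyclic   : ¬ Cycle T

  record IsSteinerTree (G : Graph n) (S : Subset n) (T : Graph n) : Set where
    field
      subgraph : IsSubgraph T G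
      tree     : IsTree T
      spans    : S ⊆ V T
      leaves   : ∀ {w} → IsLeaf T w → w ∈ S

  EdgeDisjoint : Graph n → Graph n → Set
  EdgeDisjoint H K = ∀ u v → Adj H u v → ¬ Adj K u v

  InternallyDisjoint : ∀ {R R′ : Fin n → Fin n → Set} {x y} → Star R x y → Star R′ x y → Set
  InternallyDisjoint {x = x} {y = y} P Q =
    ∀ w → w List.∈ vertices P → w List.∈ vertices Q → w ≡ x ⊎ w ≡ y

  record CompletelyIndependent (S : Subset n) {k : ℕ} (T : Fin k → Graph n) : Set where
    field
      edgeDisjoint : ∀ p q → p Fin.< q → EdgeDisjoint (T p) (T q)
      meetInS      : ∀ p q → p Fin.< q → V (T p) ∩ V (T q) ≡ S
      -- In a tree the path between two given vertices exists and is unique, so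
      -- quantifying over all such paths P and Q speaks about "the" paths.
      pathDisjoint : ∀ p q → p Fin.< q →
                     ∀ x₁ x₂ → x₁ ∈ S → x₂ ∈ S → x₁ ≢ x₂ →
                     (P : Walk (T p) x₁ x₂) → IsPath P →
                     (Q : Walk (T q) x₁ x₂) → IsPath Q →
                     InternallyDisjoint P Q

{-# OPTIONS --safe #-}

-- Call the component of T − w containing a neighbour a of w the branch of w at a. In a tree the
-- branches at distinct neighbours are distinct, and in a Steiner tree every branch contains a
-- terminal: walk away from w until a vertex of S is met, which happens at the latest at a leaf.
-- If w has degree at least two in two completely independent Steiner trees, then w ∈ S and
-- S ∖ {w} is split into at least two classes by the branches of each tree. Two nontrivial
-- partitions always have a common pair of separated elements x₁, x₂; the paths between
-- them in both trees pass through w, contradicting internal disjointness.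
-- Conversely, an inner vertex of a path, or a vertex of a Steiner tree outside S, has degree at
-- least two.
module Submission where

open import Data.Empty using (⊥)
open import Data.Nat using (ℕ; suc; _≤_; _<_; s≤s; z<s)
import Data.Nat.Properties as ℕ
open import Data.Fin as Fin using (Fin)
open import Data.Fin.Properties as Fin using (_≟_; any?)
open import Data.Fin.Subset using (Subset; _∈_; _⊆_; _-_; ∣_∣; ⁅_⁆; ⊤)
open import Data.Fin.Subset.Properties
  using (_∈?_; x∈⁅x⁆; x∈⁅y⁆⇒x≡y; ∣⁅x⁆∣≡1; p⊆q⇒∣p∣≤∣q∣; p⊂q⇒∣p∣<∣q∣; x∈p⇒∣p-x∣<∣p∣;
         x∈p∧x≢y⇒x∈p-y; ∈⊤; ∣⊤∣≡n; ⊆-antisym; x∈p∩q⁺; x∈p∩q⁻)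
open import Data.List using (length)
import Data.List.Membership.Propositional as List
open import Data.List.Relation.Unary.All using ([]; _∷_)
open import Data.List.Relation.Unary.All.Properties using (¬Any⇒All¬; All¬⇒¬Any)
open import Data.List.Relation.Unary.AllPairs using ([]; _∷_)
open import Data.List.Relation.Unary.Any as Any using (here; there)
open import Data.Product using (Σ; ∃-syntax; _×_; _,_)
open import Data.Sum using (_⊎_; inj₁; inj₂; [_,_]′)
open import Function using (_∘_)
open import Function.Bundles using (_⇔_; mk⇔)
open import Relation.Binary.Construct.Closure.ReflexiveTransitive
  using (Star; ε; _◅_; _◅◅_; reverse)
open import Relation.Binary.Definitions using (tri<; tri≈; tri>)
open import Relation.Binary.PropositionalEquality using (_≡_; _≢_; refl; sym; subst; ≢-sym)
open import Relation.Nullary using (¬_; yes; no; contradiction; ¬?; _×-dec_; decidable-stable)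
open import Defs

module _ {n : ℕ} where

  -- Cardinalities of finite subsets.

  distinct⇒1<∣p∣ : ∀ {p : Subset n} {u v} → u ∈ p → v ∈ p → u ≢ v → 1 < ∣ p ∣
  distinct⇒1<∣p∣ {p} {u} {v} u∈p v∈p u≢v =
    subst (_< ∣ p ∣) (∣⁅x⁆∣≡1 u)
      (p⊂q⇒∣p∣<∣q∣ ((λ x∈ → subst (_∈ p) (sym (x∈⁅y⁆⇒x≡y u x∈)) u∈p)
                   , v , v∈p , λ v∈ → u≢v (sym (x∈⁅y⁆⇒x≡y u v∈))))

  1<∣p∣⇒∃≢ : ∀ {p : Subset n} → 1 < ∣ p ∣ → ∀ v → ∃[ u ] (u ∈ p × u ≢ v)
  1<∣p∣⇒∃≢ {p} 1<∣p∣ v with any? (λ u → (u ∈? p) ×-dec ¬? (u ≟ v))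
  ... | yes found = found
  ... | no ¬found = contradiction (subst (∣ p ∣ ≤_) (∣⁅x⁆∣≡1 v) (p⊆q⇒∣p∣≤∣q∣ p⊆⁅v⁆)) (ℕ.<⇒≱ 1<∣p∣)
    where
    p⊆⁅v⁆ : p ⊆ ⁅ v ⁆
    p⊆⁅v⁆ {u} u∈p = subst (_∈ ⁅ v ⁆)
      (sym (decidable-stable (u ≟ v) λ u≢v → ¬found (u , u∈p , u≢v))) (x∈⁅x⁆ v)

  u∈p⇒0<∣p∣ : ∀ {p : Subset n} {u} → u ∈ p → 0 < ∣ p ∣
  u∈p⇒0<∣p∣ {p} {u} u∈p = subst (_≤ ∣ p ∣) (∣⁅x⁆∣≡1 u)
    (p⊆q⇒∣p∣≤∣q∣ λ x∈ → subst (_∈ p) (sym (x∈⁅y⁆⇒x≡y u x∈)) u∈p)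

  -- Walks, paths and degrees along them.

  module _ {R : Fin n → Fin n → Set} where

    start∈vertices : ∀ {u v} (P : Star R u v) → u List.∈ vertices P
    start∈vertices ε       = here refl
    start∈vertices (_ ◅ _) = here refl

    end∈vertices : ∀ {u v} (P : Star R u v) → v List.∈ vertices P
    end∈vertices ε       = here refl
    end∈vertices (_ ◅ P) = there (end∈vertices P)

    0<length-vertices : ∀ {u v} (P : Star R u v) → 0 < length (vertices P)
    0<length-vertices ε       = z<s
    0<length-vertices (_ ◅ _) = z<s

    suffix : ∀ {u v x} (P : Star R u v) → IsPath P → x List.∈ vertices P →
             Σ (Star R x v) λ Q → IsPath Q × (∀ {y} → y List.∈ vertices Q → y List.∈ vertices P)
    suffix ε       path       (here refl) = ε , path , λ y∈ → y∈
    suffix (e ◅ P) path       (here refl) = e ◅ P , path , λ y∈ → y∈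
    suffix (e ◅ P) (_ ∷ path) (there x∈P) =
      let Q , pathQ , Q⊆P = suffix P path x∈P in Q , pathQ , there ∘ Q⊆P

    -- If `u` recurs on the path found for the tail, everything before the recurrence is dropped.
    -- The inclusion of vertices lets the path inherit that a walk avoids `w`.
    walk⇒path : ∀ {u v} (P : Star R u v) →
                Σ (Star R u v) λ Q → IsPath Q × (∀ {y} → y List.∈ vertices Q → y List.∈ vertices P)
    walk⇒path ε = ε , [] ∷ [] , λ y∈ → y∈
    walk⇒path {u} (e ◅ P) with walk⇒path P
    ... | Q , pathQ , Q⊆P with Any.any? (u ≟_) (vertices Q)
    ...   | yes u∈Q = let Q′ , pathQ′ , Q′⊆Q = suffix Q pathQ u∈Q in Q′ , pathQ′ , there ∘ Q⊆P ∘ Q′⊆Q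
    ...   | no u∉Q  = e ◅ Q , ¬Any⇒All¬ _ u∉Q ∷ pathQ ,
                      λ { (here eq) → here eq ; (there y∈Q) → there (Q⊆P y∈Q) }

  module _ {T : Graph n} where

    -- The predecessor and the successor of `w` on the path are two distinct neighbours of `w`.
    inner⇒1<degree : ∀ {x y w} (P : Walk T x y) → IsPath P → w List.∈ vertices P →
                     w ≢ x → w ≢ y → 1 < degree T w
    inner⇒1<degree ε _ (here w≡x) w≢x _ = contradiction w≡x w≢x
    inner⇒1<degree (_ ◅ _) _ (here w≡x) w≢x _ = contradiction w≡x w≢x
    inner⇒1<degree {w = w} (_◅_ {j = m} e P) (x∉P ∷ path) (there w∈P) w≢x w≢y with w ≟ m
    ... | no w≢m = inner⇒1<degree P path w∈P w≢m w≢y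
    inner⇒1<degree (e ◅ ε) _ _ _ w≢y | yes refl = contradiction refl w≢y
    inner⇒1<degree (e ◅ (f ◅ P)) (x∉P ∷ _) _ _ _ | yes refl =
      distinct⇒1<∣p∣ (N-sym T e) f
        λ { refl → All¬⇒¬Any x∉P (there (start∈vertices P)) }

  -- Branches of a tree at a vertex.

  Away : Graph n → Fin n → Fin n → Fin n → Set
  Away T w u v = Adj T u v × u ≢ w × v ≢ w

  record InBranch (T : Graph n) (w a x : Fin n) : Set where
    constructor branch
    field
      root  : Adj T w a
      apart : x ≢ w
      link  : Star (Away T w) x a
  open InBranch

  module _ {T : Graph n} {w : Fin n} where

    Away-sym : ∀ {u v} → Away T w u v → Away T w v u
    Away-sym (e , u≢w , v≢w) = N-sym T e , v≢w , u≢w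

    -- Stopping at an arbitrary `x` on `P` serves two uses: reaching the end of a walk, and reaching
    -- a vertex where a walk would close up.
    avoiding⇒Away : ∀ {u v x} (P : Walk T u v) → ¬ w List.∈ vertices P → x List.∈ vertices P →
                    Star (Away T w) u x
    avoiding⇒Away ε       w∉P (here refl) = ε
    avoiding⇒Away (_ ◅ _) w∉P (here refl) = ε
    avoiding⇒Away (e ◅ P) w∉P (there x∈P) =
      (e , (λ { refl → w∉P (here refl) })
         , (λ { refl → w∉P (there (start∈vertices P)) }))
      ◅ avoiding⇒Away P (w∉P ∘ there) x∈P

    Away⇒avoiding : ∀ {u v} → u ≢ w → Star (Away T w) u v →
                    Σ (Walk T u v) λ P → ¬ w List.∈ vertices P
    Away⇒avoiding u≢w ε = ε , λ { (here w≡u) → u≢w (sym w≡u) }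
    Away⇒avoiding u≢w ((e , _ , v≢w) ◅ P) =
      let Q , w∉Q = Away⇒avoiding v≢w P
      in e ◅ Q , λ { (here w≡u) → u≢w (sym w≡u) ; (there w∈Q) → w∉Q w∈Q }

    neighbour≢ : ∀ {a} → Adj T w a → a ≢ w
    neighbour≢ e refl = N-irrefl T e

    -- A path from `a` to `b` that avoids `w` would close up through `w` to a cycle.
    branches-disjoint : ¬ Cycle T → ∀ {a b} → Adj T w a → Adj T w b → a ≢ b →
                        ¬ Star (Away T w) a b
    branches-disjoint acyclic {a} {b} wa wb a≢b P =
      let Q , w∉Q         = Away⇒avoiding (neighbour≢ wa) P
          Q′ , path , Q′⊆ = walk⇒path Q
      in acyclic record
        { path    = wa ◅ Q′
        ; isPath  = ¬Any⇒All¬ _ (w∉Q ∘ Q′⊆) ∷ path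
        ; long    = s≤s (2≤length Q′)
        ; closing = N-sym T wb
        }
      where
      2≤length : (Q : Walk T a b) → 2 ≤ length (vertices Q)
      2≤length ε       = contradiction refl a≢b
      2≤length (_ ◅ Q) = s≤s (0<length-vertices Q)

    branch-unique : ¬ Cycle T → ∀ {a b x} → InBranch T w a x → InBranch T w b x → a ≡ b
    branch-unique acyclic {a} {b} xa xb = decidable-stable (a ≟ b) λ a≢b →
      branches-disjoint acyclic (root xa) (root xb) a≢b (reverse Away-sym (link xa) ◅◅ link xb)

    -- The root is the vertex just before the first visit of the walk to `w`.
    branch-exists : ∀ {x} → x ≢ w → Walk T x w → ∃[ a ] InBranch T w a x
    branch-exists x≢w ε = contradiction refl x≢w
    branch-exists x≢w (_◅_ {j = y} e P) with y ≟ w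
    ... | yes refl = _ , branch (N-sym T e) x≢w ε
    ... | no y≢w   = let a , ya = branch-exists y≢w P
                     in a , branch (root ya) x≢w ((e , x≢w , y≢w) ◅ link ya)

    distinct-branches⇒through : ¬ Cycle T → ∀ {a b x y} → InBranch T w a x → InBranch T w b y → a ≢ b →
                                (P : Walk T x y) → w List.∈ vertices P
    distinct-branches⇒through acyclic xa yb a≢b P =
      decidable-stable (Any.any? (w ≟_) (vertices P)) λ w∉P →
        a≢b (branch-unique acyclic xa
          (branch (root yb) (apart xa) (avoiding⇒Away P w∉P (end∈vertices P) ◅◅ link yb)))

  -- Terminals in the branches of a Steiner tree.

  module _ {G T : Graph n} {S : Subset n} (steiner : IsSteinerTree G S T) where
    open IsSteinerTree steiner
    open IsTree tree
    open IsConnected connected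

    -- A walk to a terminal other than `u` gives `u` a neighbour; were it the only one, `u` would be
    -- a leaf and hence in `S`.
    nonterminal⇒1<degree : 2 ≤ ∣ S ∣ → ∀ {u} → u ∈ V T → ¬ u ∈ S → 1 < degree T u
    nonterminal⇒1<degree 2≤∣S∣ {u} u∈T u∉S with 1<∣p∣⇒∃≢ 2≤∣S∣ u
    ... | s , s∈S , s≢u with joined u∈T (spans s∈S)
    ...   | ε     = contradiction refl s≢u
    ...   | e ◅ _ = ℕ.≤∧≢⇒< (u∈p⇒0<∣p∣ e) λ 1≡d → u∉S (leaves (u∈T , sym 1≡d))

    -- F contains all vertices off the path u ∷ vertices P from u to w walked so far, so that it
    -- shrinks with every step.
    extend-to-terminal :
      2 ≤ ∣ S ∣ → ∀ {w a} (m : ℕ) (F : Subset n) → ∣ F ∣ < m →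
      ∀ {u v} → Adj T u v → (P : Walk T v w) → ¬ u List.∈ vertices P →
      (∀ {x} → x ≢ u → ¬ x List.∈ vertices P → x ∈ F) →
      InBranch T w a u → ∃[ s ] (s ∈ S × InBranch T w a s)
    extend-to-terminal 2≤∣S∣ {w} (suc m) F (s≤s ∣F∣≤m) {u} {v} uv P u∉P fresh inA with u ∈? S
    ... | yes u∈S = u , u∈S , inA
    ... | no u∉S with 1<∣p∣⇒∃≢ (nonterminal⇒1<degree 2≤∣S∣ (N-vertex T uv) u∉S) v
    ...   | v′ , uv′ , v′≢v =
      extend-to-terminal 2≤∣S∣ m (F - v′) (ℕ.<-≤-trans (x∈p⇒∣p-x∣<∣p∣ (fresh v′≢u v′∉P)) ∣F∣≤m)
        (N-sym T uv′) (uv ◅ P)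
        (λ { (here v′≡u) → v′≢u v′≡u ; (there v′∈P) → v′∉P v′∈P })
        (λ x≢v′ x∉ → x∈p∧x≢y⇒x∈p-y (fresh (x∉ ∘ here) (x∉ ∘ there)) x≢v′)
        (branch (root inA) v′≢w ((N-sym T uv′ , v′≢w , apart inA) ◅ link inA))
      where
      v′≢u : v′ ≢ u
      v′≢u = neighbour≢ {T = T} uv′
      -- A return to `P` would join the neighbours `v` and `v′` of `u` while avoiding `u`.
      v′∉P : ¬ v′ List.∈ vertices P
      v′∉P v′∈P = branches-disjoint acyclic uv uv′ (≢-sym v′≢v) (avoiding⇒Away {T = T} P u∉P v′∈P)
      v′≢w : v′ ≢ w
      v′≢w refl = v′∉P (end∈vertices P)

    branch-has-terminal : 2 ≤ ∣ S ∣ → ∀ {w a} → Adj T w a → ∃[ s ] (s ∈ S × InBranch T w a s)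
    branch-has-terminal 2≤∣S∣ {w} {a} wa =
      -- The path walked so far is the single edge between `w` and `a`. Since `F` starts as all `n`
      -- vertices, the strict bound on its size is `suc n`.
      extend-to-terminal 2≤∣S∣ (suc n) ⊤ (s≤s (ℕ.≤-reflexive (∣⊤∣≡n n))) (N-sym T wa) ε
        (λ { (here a≡w) → a≢w a≡w }) (λ _ _ → ∈⊤) (branch wa a≢w ε)
      where
      a≢w : a ≢ w
      a≢w = neighbour≢ {T = T} wa

    terminal-branch : ∀ {w s} → w ∈ V T → s ∈ S → s ≢ w → ∃[ a ] InBranch T w a s
    terminal-branch w∈T s∈S s≢w = branch-exists s≢w (joined (spans s∈S) w∈T)

  -- Terminals separated by a vertex in both trees.

  Separated : Graph n → (w x y : Fin n) → Set
  Separated T w x y = ∃[ a ] ∃[ b ] (a ≢ b × InBranch T w a x × InBranch T w b y)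

  -- Take terminals `s` and `t` from different branches of `T`. If `T′` does not separate them, a
  -- terminal `z` from another branch of `T′` is separated there from both.
  commonly-separated :
    ∀ {G T T′ : Graph n} {S} → IsSteinerTree G S T → IsSteinerTree G S T′ → 2 ≤ ∣ S ∣ →
    ∀ {w} → 1 < degree T w → 1 < degree T′ w →
    ∃[ x ] ∃[ y ] (x ∈ S × y ∈ S × Separated T w x y × Separated T′ w x y)
  commonly-separated {T = T} {T′} {S} st st′ 2≤∣S∣ {w} d d′
    -- Excluding `w` is a dummy choice: any neighbour `a` will do, and `b` is then chosen different
    -- from it.
    with 1<∣p∣⇒∃≢ d w
  ... | a , wa , _ with 1<∣p∣⇒∃≢ d a
  ... | b , wb , b≢a
    with branch-has-terminal st 2≤∣S∣ wa | branch-has-terminal st 2≤∣S∣ wb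
  ... | s , s∈S , sa | t , t∈S , tb
    with 1<∣p∣⇒∃≢ d′ w
  ... | _ , we , _
    with terminal-branch st′ (N-vertex T′ we) s∈S (apart sa)
       | terminal-branch st′ (N-vertex T′ we) t∈S (apart tb)
  ... | c , sc | c′ , tc′ with c ≟ c′
  ... | no c≢c′ = s , t , s∈S , t∈S , (a , b , ≢-sym b≢a , sa , tb) , (c , c′ , c≢c′ , sc , tc′)
  ... | yes refl with 1<∣p∣⇒∃≢ d′ c
  ... | e , wd , e≢c with branch-has-terminal st′ 2≤∣S∣ wd
  ... | z , z∈S , ze with terminal-branch st (N-vertex T wa) z∈S (apart ze)
  ... | f , zf with a ≟ f
  -- In `T`, the branch of `z` cannot be both that of `s` and that of `t`, so `z` is paired with one
  -- it differs from.
  ... | no a≢f   = s , z , s∈S , z∈S , (a , f , a≢f , sa , zf) , (c , e , ≢-sym e≢c , sc , ze)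
  ... | yes refl = t , z , t∈S , z∈S , (b , a , b≢a , tb , zf) , (c , e , ≢-sym e≢c , tc′ , ze)

  separated⇒path-through : ∀ {G T : Graph n} {S} → IsSteinerTree G S T →
    ∀ {w x y} → x ∈ S → y ∈ S → Separated T w x y →
    Σ (Walk T x y) λ P → IsPath P × w List.∈ vertices P
  separated⇒path-through st x∈S y∈S (_ , _ , a≢b , xa , yb) =
    let P , path , _ = walk⇒path (joined (spans x∈S) (spans y∈S))
    in P , path , distinct-branches⇒through acyclic xa yb a≢b P
    where
    open IsSteinerTree st
    open IsTree tree
    open IsConnected connected

-- Bridges complete independence, which speaks of `p < q`, and the criterion, which speaks of
-- distinct indices.
ordered⇒distinct : ∀ {k} (R : Fin k → Fin k → Set) → (∀ i j → R i j → R j i) →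
                   (∀ i j → i Fin.< j → R i j) → ∀ i j → i ≢ j → R i j
ordered⇒distinct R R-sym R< i j i≢j with Fin.<-cmp i j
... | tri< i<j _ _ = R< i j i<j
... | tri≈ _ i≡j _ = contradiction i≡j i≢j
... | tri> _ _ j<i = R-sym j i (R< j i j<i)

-- The two directions of the equivalence.

theorem2p1 : ∀ {n : ℕ} (G : Graph n) → IsConnected G →
    (S : Subset n) → S ⊆ V G → 2 ≤ ∣ S ∣ →
    (k : ℕ) → 2 ≤ k →
    (T : Fin k → Graph n) → (∀ i → IsSteinerTree G S (T i)) →
    CompletelyIndependent S T ⇔
    ((∀ i j → i ≢ j → EdgeDisjoint (T i) (T j)) ×
    (∀ w → w ∈ V G → ∀ i j → 1 < degree (T i) w → 1 < degree (T j) w → i ≡ j))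
theorem2p1 {n} G _ S _ 2≤∣S∣ k _ T steiner = mk⇔ forward backward
  where
  open CompletelyIndependent
  open IsSteinerTree using (spans; subgraph)

  forward : CompletelyIndependent S T → _
  forward ci =
      ordered⇒distinct (λ i j → EdgeDisjoint (T i) (T j)) (λ _ _ disj u v Ki Kj → disj u v Kj Ki)
        (edgeDisjoint ci)
    , λ w _ i j di dj → decidable-stable (i Fin.≟ j) λ i≢j →
        ordered⇒distinct (λ i j → ¬ (1 < degree (T i) w × 1 < degree (T j) w))
          (λ _ _ ¬both (di , dj) → ¬both (dj , di)) (both-large w) i j i≢j (di , dj)
    where
    both-large : ∀ w p q → p Fin.< q → ¬ (1 < degree (T p) w × 1 < degree (T q) w)
    both-large w p q p<q (dp , dq)
      with commonly-separated (steiner p) (steiner q) 2≤∣S∣ dp dq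
    ... | x , y , x∈S , y∈S , sep@(_ , _ , a≢b , xa , yb) , sep′
      with separated⇒path-through (steiner p) x∈S y∈S sep
         | separated⇒path-through (steiner q) x∈S y∈S sep′
    ... | P , pathP , w∈P | Q , pathQ , w∈Q =
      -- The common vertex `w` would have to be `x` or `y`, but both lie in branches at `w`.
      [ ≢-sym (apart xa) , ≢-sym (apart yb) ]′
        (pathDisjoint ci p q p<q x y x∈S y∈S x≢y P pathP Q pathQ w w∈P w∈Q)
      where
      open InBranch
      x≢y : x ≢ y
      x≢y refl = a≢b (branch-unique (IsTree.acyclic (IsSteinerTree.tree (steiner p))) xa yb)

  backward : _ → CompletelyIndependent S T
  backward (disjoint , large-once) = record
    { edgeDisjoint = λ p q p<q → disjoint p q (Fin.<⇒≢ p<q)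
    ; meetInS      = λ p q p<q → ⊆-antisym
        (λ w∈ → let w∈p , w∈q = x∈p∩q⁻ _ _ w∈ in
          decidable-stable (_ ∈? S) λ w∉S →
            not-both p<q w∈p (nonterminal⇒1<degree (steiner p) 2≤∣S∣ w∈p w∉S)
                             (nonterminal⇒1<degree (steiner q) 2≤∣S∣ w∈q w∉S))
        (λ w∈S → x∈p∩q⁺ (spans (steiner p) w∈S , spans (steiner q) w∈S))
    ; pathDisjoint = λ p q p<q x y x∈S _ _ P pathP Q pathQ w w∈P w∈Q →
        inner p<q P pathP Q pathQ w∈P w∈Q
    }
    where
    not-both : ∀ {p q w} → p Fin.< q → w ∈ V (T p) → 1 < degree (T p) w → 1 < degree (T q) w → ⊥
    not-both {p} {q} {w} p<q w∈p dp dq =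
      Fin.<⇒≢ p<q (large-once w (IsSubgraph.V-⊆ (subgraph (steiner p)) w∈p) p q dp dq)

    inner : ∀ {p q x y w} → p Fin.< q → (P : Walk (T p) x y) → IsPath P →
            (Q : Walk (T q) x y) → IsPath Q →
            w List.∈ vertices P → w List.∈ vertices Q → w ≡ x ⊎ w ≡ y
    inner {p} {q} {x} {y} {w} p<q P pathP Q pathQ w∈P w∈Q with w ≟ x | w ≟ y
    ... | yes w≡x | _       = inj₁ w≡x
    ... | no _    | yes w≡y = inj₂ w≡y
    ... | no w≢x  | no w≢y
      with dp ← inner⇒1<degree {T = T p} P pathP w∈P w≢x w≢y
      -- Some neighbour of `w` is extracted only to place `w` in `V (T p)`, hence in `V G`.
      with _ , e , _ ← 1<∣p∣⇒∃≢ dp w =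
      contradiction (inner⇒1<degree {T = T q} Q pathQ w∈Q w≢x w≢y) (not-both p<q (N-vertex (T p) e) dp)
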